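{- The proof system $\mathsf{SDELKh}$ is sound over the class of all models: for every formula $\varphi\in\mathbf{DELKh}$, if $\varphi$ is provable in $\mathsf{SDELKh}$ then $M,w\vDash\varphi$ for every model $M$ and every world $w$ of $M$.
   Context: Fix a countable set $\mathbf{P}$ of proposition letters. $\mathbf{PL}$: $\alpha::=p\mid\bot\mid(\alpha\land\alpha)\mid(\alpha\lor\alpha)\mid(\alpha\to\alpha)$, $p\in\mathbf{P}$. $\mathbf{DELKh}$: $\varphi::=p\mid\bot\mid(\varphi\land\varphi)\mid(\varphi\lor\varphi)\mid(\varphi\to\varphi)\mid\mathsf{K}\varphi\mid\mathsf{Kh}\alpha\mid\Box\varphi$, with $p\in\mathbf{P}$, $\alpha\in\mathbf{PL}$. Abbreviations: $\neg\varphi:=\varphi\to\bot$, $\varphi\leftrightarrow\psi:=(\varphi\to\psi)\land(\psi\to\varphi)$, $\widehat{\mathsf{K}}:=\neg\mathsf{K}\neg$, $\Diamond:=\neg\Box\neg$. A model (epistemic model) is $M=\langle W,V\rangle$ with $W\ne\varnothing$ and $V:W\to\wp(\mathbf{P})$. A submodel of $M$ is $\langle W',V|_{W'}\rangle$ with $\varnothing\ne W'\subseteq W$. Resolution space: $S(p)=\{p\}$; $S(\bot)=\{\bot\}$; $S(\alpha\lor\beta)=(S(\alpha)\times\{0\})\cup(S(\beta)\times\{1\})$; $S(\alpha\land\beta)=S(\alpha)\times S(\beta)$; $S(\alpha\to\beta)=S(\beta)^{S(\alpha)}$. Resolutions at $w\in W$: $R(w,\bot)=\varnothing$; $R(w,p)=\{p\}$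 if $p\in V(w)$, else $\varnothing$; $R(w,\alpha\lor\beta)=(R(w,\alpha)\times\{0\})\cup(R(w,\beta)\times\{1\})$; $R(w,\alpha\land\beta)=R(w,\alpha)\times R(w,\beta)$; $R(w,\alpha\to\beta)=\{f\in S(\beta)^{S(\alpha)}\mid f[R(w,\alpha)]\subseteq R(w,\beta)\}$. Satisfaction $M,w\vDash\varphi$: $M,w\nvDash\bot$; $M,w\vDash p$ iff $p\in V(w)$; $\land,\lor,\to$ are classical; $M,w\vDash\Box\varphi$ iff $M',w\vDash\varphi$ for every submodel $M'$ of $M$ containing $w$; $M,w\vDash\mathsf{K}\varphi$ iff $M,v\vDash\varphi$ for all $v\in W$; $M,w\vDash\mathsf{Kh}\alpha$ iff there is $x\in S(\alpha)$ with $x\in R(v,\alpha)$ for all $v\in W$. System $\mathsf{SDELKh}$ ($p\in\mathbf{P}$; $\alpha,\beta,\alpha_i\in\mathbf{PL}$; $\varphi,\psi\in\mathbf{DELKh}$). Axioms: all (instances in $\mathbf{DELKh}$ of) propositional tautologies; $\mathsf{K}(\varphi\to\psi)\to(\mathsf{K}\varphi\to\mathsf{K}\psi)$; $\mathsf{K}\varphi\to\varphi$; $\mathsf{K}\varphi\to\mathsf{K}\mathsf{K}\varphi$; $\neg\mathsf{K}\varphi\to\mathsf{K}\neg\mathsf{K}\varphi$; $\Box(\varphi\to\psi)\to(\Box\varphi\to\Box\psi)$; $\Box\varphi\to\varphi$; $\Box\varphi\to\Box\Box\varphi$; $\mathsf{K}\Box\varphi\to\Box\mathsf{K}\varphi$;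 $\alpha\to\Box\alpha$; $\alpha\to\Diamond\mathsf{Kh}\alpha$; $\mathsf{Kh}\alpha\to\mathsf{K}\alpha$; $\mathsf{K}p\to\mathsf{Kh}p$; $\mathsf{Kh}\bot\leftrightarrow\bot$; $\mathsf{Kh}(\alpha\lor\beta)\leftrightarrow\mathsf{Kh}\alpha\lor\mathsf{Kh}\beta$; $\mathsf{Kh}(\alpha\land\beta)\leftrightarrow\mathsf{Kh}\alpha\land\mathsf{Kh}\beta$; $\mathsf{Kh}(\alpha\to\beta)\leftrightarrow\mathsf{K}\Box(\mathsf{Kh}\alpha\to\mathsf{Kh}\beta)$; $\mathsf{Kh}\alpha\to\mathsf{K}\mathsf{Kh}\alpha$; $\neg\mathsf{Kh}\alpha\to\mathsf{K}\neg\mathsf{Kh}\alpha$; and for each $k\in\mathbb{N}$, $\alpha\land\bigwedge_{1\le i\le k}\widehat{\mathsf{K}}(\alpha\land\alpha_i)\to\Diamond(\mathsf{K}\alpha\land\bigwedge_{1\le i\le k}\widehat{\mathsf{K}}\alpha_i)$. Rules: modus ponens; from $\vdash\varphi$ infer $\vdash\mathsf{K}\varphi$; from $\vdash\varphi$ infer $\vdash\Box\varphi$. -}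

module Defs where

open import Data.Bool.Base using (Bool; true; false; not) renaming (_∧_ to _and_; _∨_ to _or_)
open import Data.Empty using (⊥)
open import Data.Irrelevant using ([_])
open import Data.Nat.Base using (ℕ)
open import Data.Product.Base using (∃; _×_; _,_)
open import Data.Refinement.Base using (Refinement; value; _,_)
open import Data.Sum.Base using (_⊎_)
open import Data.Unit.Base using (⊤)
open import Data.Vec.Base using (Vec; []; _∷_; map)
open import Function.Base using (_∘_)
open import Level using (Level; Lift; suc)
open import Relation.Binary.PropositionalEquality.Core using (_≡_)
open import Relation.Nullary.Negation.Core using (¬_)
open import Relation.Unary using (Pred; _∈_; Empty; _⟨×⟩_; _⟨⊎⟩_; _⟨→⟩_)

infixr 7 _∧̇_
infixr 6 _∨̇_
infixr 5 _⇒_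
infix  8 _⟪_⟫

-- PL is `Prp P`.  The set of letters is a parameter so that tautologies can be
-- written with infinitely many letters even when P is finite.
data Prp (A : Set) : Set where
  var         : A → Prp A
  ⊥̇           : Prp A
  _∧̇_ _∨̇_ _⇒_ : Prp A → Prp A → Prp A

data DELKh (P : Set) : Set where
  var         : P → DELKh P
  ⊥̇           : DELKh P
  _∧̇_ _∨̇_ _⇒_ : DELKh P → DELKh P → DELKh P
  K □         : DELKh P → DELKh P
  Kh          : Prp P → DELKh P

_⟪_⟫ : {A P : Set} → Prp A → (A → DELKh P) → DELKh P
var a   ⟪ σ ⟫ = σ a
⊥̇       ⟪ σ ⟫ = ⊥̇
(α ∧̇ β) ⟪ σ ⟫ = α ⟪ σ ⟫ ∧̇ β ⟪ σ ⟫
(α ∨̇ β) ⟪ σ ⟫ = α ⟪ σ ⟫ ∨̇ β ⟪ σ ⟫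
(α ⇒ β) ⟪ σ ⟫ = α ⟪ σ ⟫ ⇒ β ⟪ σ ⟫

module _ {P : Set} where

  infix 4 _⇔̇_

  -- the inclusion of PL in DELKh
  ⌜_⌝ : Prp P → DELKh P
  ⌜ α ⌝ = α ⟪ var ⟫

  ¬̇_ K̂ ◇ : DELKh P → DELKh P
  ¬̇ φ = φ ⇒ ⊥̇
  K̂ φ = ¬̇ K (¬̇ φ)
  ◇ φ = ¬̇ □ (¬̇ φ)

  _⇔̇_ : DELKh P → DELKh P → DELKh P
  φ ⇔̇ ψ = (φ ⇒ ψ) ∧̇ (ψ ⇒ φ)

  -- The empty conjunction is verum.
  ⋀ : ∀ {k} → Vec (DELKh P) k → DELKh P
  ⋀ []           = ¬̇ ⊥̇
  ⋀ (φ ∷ [])     = φ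
  ⋀ (φ ∷ ψ ∷ φs) = φ ∧̇ ⋀ (ψ ∷ φs)

eval : {A : Set} → (A → Bool) → Prp A → Bool
eval v (var a) = v a
eval v ⊥̇       = false
eval v (α ∧̇ β) = eval v α and eval v β
eval v (α ∨̇ β) = eval v α or eval v β
eval v (α ⇒ β) = not (eval v α) or eval v β

Tautology : {A : Set} → Prp A → Set
Tautology α = ∀ v → eval v α ≡ true

record Model (P : Set) (ℓ : Level) : Set (suc ℓ) where
  field
    World    : Set ℓ
    V        : World → Pred P ℓ
    nonempty : ¬ ¬ World

open Model

module _ {P : Set} {ℓ : Level} where

  record Submodel (M : Model P ℓ) : Set (suc ℓ) where
    field
      worlds   : Pred (World M) ℓ
      nonempty : ¬ Empty worlds

  open Submodel

  -- Membership proofs are irrelevant in `Refinement`, so a world of M occurs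
  -- at most once in the restricted model.
  ⟦_⟧ : {M : Model P ℓ} → Submodel M → Model P ℓ
  ⟦_⟧ {M} N = record
    { World    = Refinement (World M) (worlds N)
    ; V        = V M ∘ value
    ; nonempty = λ none → nonempty N (λ w w∈N → none (w , [ w∈N ]))
    }

  -- The singletons {p} and {⊥} are both represented by ⊤, the coproduct
  -- (S α × {0}) ∪ (S β × {1}) by ⊎.
  S : Prp P → Set
  S (var p) = ⊤
  S ⊥̇       = ⊤
  S (α ∨̇ β) = S α ⊎ S β
  S (α ∧̇ β) = S α × S β
  S (α ⇒ β) = S α → S β

  R : (M : Model P ℓ) → World M → (α : Prp P) → Pred (S α) ℓ
  R M w (var p) = λ _ → p ∈ V M w
  R M w ⊥̇       = λ _ → Lift ℓ ⊥
  R M w (α ∨̇ β) = R M w α ⟨⊎⟩ R M w β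
  R M w (α ∧̇ β) = R M w α ⟨×⟩ R M w β
  R M w (α ⇒ β) = R M w α ⟨→⟩ R M w β

  infix 3 _,_⊨_

  -- □ quantifies over subsets, which raises the universe level; hence the Lifts.
  _,_⊨_ : (M : Model P ℓ) → World M → DELKh P → Set (suc ℓ)
  M , w ⊨ var p = Lift (suc ℓ) (p ∈ V M w)
  M , w ⊨ ⊥̇     = Lift (suc ℓ) ⊥
  M , w ⊨ φ ∧̇ ψ = (M , w ⊨ φ) × (M , w ⊨ ψ)
  M , w ⊨ φ ∨̇ ψ = (M , w ⊨ φ) ⊎ (M , w ⊨ ψ)
  M , w ⊨ φ ⇒ ψ = (M , w ⊨ φ) → (M , w ⊨ ψ)
  M , w ⊨ □ φ   = (N : Submodel M) (w∈N : w ∈ worlds N) → ⟦ N ⟧ , (w , [ w∈N ]) ⊨ φ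
  M , w ⊨ K φ   = ∀ v → M , v ⊨ φ
  M , w ⊨ Kh α  = Lift (suc ℓ) (∃ λ x → ∀ v → x ∈ R M v α)

-- Derivability in SDELKh.
infix 3 ⊢_

data ⊢_ {P : Set} : DELKh P → Set where
  taut  : (τ : Prp ℕ) → Tautology τ → (σ : ℕ → DELKh P) → ⊢ τ ⟪ σ ⟫
  K-K   : ∀ φ ψ → ⊢ K (φ ⇒ ψ) ⇒ K φ ⇒ K ψ
  K-T   : ∀ φ → ⊢ K φ ⇒ φ
  K-4   : ∀ φ → ⊢ K φ ⇒ K (K φ)
  K-5   : ∀ φ → ⊢ ¬̇ K φ ⇒ K (¬̇ K φ)
  □-K   : ∀ φ ψ → ⊢ □ (φ ⇒ ψ) ⇒ □ φ ⇒ □ ψ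
  □-T   : ∀ φ → ⊢ □ φ ⇒ φ
  □-4   : ∀ φ → ⊢ □ φ ⇒ □ (□ φ)
  K□    : ∀ φ → ⊢ K (□ φ) ⇒ □ (K φ)
  pers  : ∀ α → ⊢ ⌜ α ⌝ ⇒ □ ⌜ α ⌝
  ◇Kh   : ∀ α → ⊢ ⌜ α ⌝ ⇒ ◇ (Kh α)
  Kh-K  : ∀ α → ⊢ Kh α ⇒ K ⌜ α ⌝
  K-Kh  : ∀ p → ⊢ K (var p) ⇒ Kh (var p)
  Kh-⊥  : ⊢ Kh ⊥̇ ⇔̇ ⊥̇
  Kh-∨  : ∀ α β → ⊢ Kh (α ∨̇ β) ⇔̇ Kh α ∨̇ Kh β
  Kh-∧  : ∀ α β → ⊢ Kh (α ∧̇ β) ⇔̇ Kh α ∧̇ Kh β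
  Kh-⇒  : ∀ α β → ⊢ Kh (α ⇒ β) ⇔̇ K (□ (Kh α ⇒ Kh β))
  Kh-4  : ∀ α → ⊢ Kh α ⇒ K (Kh α)
  Kh-5  : ∀ α → ⊢ ¬̇ Kh α ⇒ K (¬̇ Kh α)
  ◇K    : ∀ k (α : Prp P) (αs : Vec (Prp P) k) →
          ⊢ ⌜ α ⌝ ∧̇ ⋀ (map (λ αᵢ → K̂ ⌜ α ∧̇ αᵢ ⌝) αs) ⇒ ◇ (K ⌜ α ⌝ ∧̇ ⋀ (map (λ αᵢ → K̂ ⌜ αᵢ ⌝) αs))
  mp    : ∀ {φ ψ} → ⊢ φ ⇒ ψ → ⊢ φ → ⊢ ψ
  nec-K : ∀ {φ} → ⊢ φ → ⊢ K φ
  nec-□ : ∀ {φ} → ⊢ φ → ⊢ □ φ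

-- Four facts carry the nontrivial axioms.  A PL-formula is true at a world iff
-- it has a resolution there.  Its resolutions at a world depend only on the
-- valuation of that world, hence survive passing to submodels.  The worlds with
-- a given resolution, or with some resolution, form the submodels witnessing ◇
-- and those tested by □ in the axiom for Kh of an implication.  Finally, total
-- bisimulations preserve satisfaction, so that a submodel of a submodel can be
-- traded for a submodel.
module Submission where

open import Defs
open import Axiom.ExcludedMiddle using (ExcludedMiddle)
open import Data.Irrelevant using ([_])
open import Data.Nat.Base using (ℕ)
open import Data.Product.Base using (∃; _×_; _,_; proj₁; proj₂)
open import Data.Refinement.Base using (value; _,_)
open import Data.Sum.Base using (inj₁; inj₂)
open import Data.Unit.Base using (⊤; tt)
open import Data.Vec.Base using (Vec; []; _∷_; map)
open import Function.Base using (_∘_; flip; id; const)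
open import Function.Bundles using (_↣_)
open import Level using (Level; Lift; suc; lift; lower)
open import Relation.Binary.Core using (REL)
open import Relation.Binary.PropositionalEquality.Core using (_≡_; refl; sym; cong; subst)
open import Relation.Nullary.Decidable.Core using (yes; no; does; proof; map′; recompute)
open import Relation.Nullary.Negation.Core using (contradiction)
open import Relation.Nullary.Reflects using (Reflects; ofⁿ; invert; _×-reflects_; _⊎-reflects_; _→-reflects_)
open import Relation.Unary using (Pred; _∈_; _⊆_; Satisfiable)

open Model
open Submodel

module _ {P : Set} {ℓ : Level} where

  -- Even `S ⊥̇` is a singleton, so no space of resolutions is empty. The element serves as a
  -- default value of functions at arguments where nothing is required of them.
  S-inhabited : (α : Prp P) → S {ℓ = ℓ} α
  S-inhabited (var p) = tt
  S-inhabited ⊥̇       = tt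
  S-inhabited (α ∧̇ β) = S-inhabited α , S-inhabited β
  S-inhabited (α ∨̇ β) = inj₁ (S-inhabited α)
  S-inhabited (α ⇒ β) = const (S-inhabited β)

  -- `S α` does not mention the model, so one candidate can be tested in both. The antecedent of an
  -- implication reverses the direction, but the equation is symmetric.
  R-resp-V : {M M′ : Model P ℓ} {w : World M} {w′ : World M′} (α : Prp P) →
             V M w ≡ V M′ w′ → R M w α ⊆ R M′ w′ α
  R-resp-V (var p) eq          p∈V       = subst (p ∈_) eq p∈V
  R-resp-V (α ∧̇ β) eq          (rα , rβ) = R-resp-V α eq rα , R-resp-V β eq rβ
  R-resp-V (α ∨̇ β) eq {inj₁ _} rα        = R-resp-V α eq rα
  R-resp-V (α ∨̇ β) eq {inj₂ _} rβ        = R-resp-V β eq rβ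
  R-resp-V (α ⇒ β) eq          rf        = R-resp-V β eq ∘ rf ∘ R-resp-V α (sym eq)

  Resolvable : (M : Model P ℓ) → Prp P → Pred (World M) ℓ
  Resolvable M α w = Satisfiable (R M w α)

  submodel : {M : Model P ℓ} (Q : Pred (World M) ℓ) → Satisfiable Q → Submodel M
  submodel Q (w , w∈Q) = record { worlds = Q ; nonempty = λ empty → empty w w∈Q }

  ⋀-map : {M M′ : Model P ℓ} {w : World M} {w′ : World M′} {f g : Prp P → DELKh P} →
          (∀ α → M , w ⊨ f α → M′ , w′ ⊨ g α) →
          ∀ {k} (αs : Vec (Prp P) k) → M , w ⊨ ⋀ (map f αs) → M′ , w′ ⊨ ⋀ (map g αs)
  ⋀-map h []           _        = id
  ⋀-map h (α ∷ [])     x        = h α x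
  ⋀-map h (α ∷ β ∷ αs) (x , xs) = h α x , ⋀-map h (β ∷ αs) xs

  -- `K` and `Kh` range over all worlds, so the usual zigzag conditions become totality on both
  -- sides.
  record TotalBisimulation (M M′ : Model P ℓ) : Set (suc ℓ) where
    field
      _∼_     : REL (World M) (World M′) ℓ
      V-resp  : ∀ {w w′} → w ∼ w′ → V M w ≡ V M′ w′
      forth   : ∀ w → ∃ λ w′ → w ∼ w′
      back    : ∀ w′ → ∃ λ w → w ∼ w′

  open TotalBisimulation

  symmetric : {M M′ : Model P ℓ} → TotalBisimulation M M′ → TotalBisimulation M′ M
  symmetric B = record
    { _∼_    = flip (_∼_ B)
    ; V-resp = sym ∘ V-resp B
    ; forth  = back B
    ; back   = forth B
    }

  module _ (em : ExcludedMiddle (suc ℓ)) where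

    em-ℓ : ExcludedMiddle ℓ
    em-ℓ = map′ lower lift em

    -- Excluded middle decides membership, and a decidable proposition can be recomputed from the
    -- irrelevant proof stored in a world of `⟦ N ⟧`.
    value∈ : {M : Model P ℓ} (N : Submodel M) (u : World ⟦ N ⟧) → value u ∈ worlds N
    value∈ N (_ , [ v∈N ]) = recompute em-ℓ v∈N

    image : {M M′ : Model P ℓ} → TotalBisimulation M M′ → Submodel M → Submodel M′
    image B N = record
      { worlds   = λ v′ → ∃ λ v → v ∈ worlds N × _∼_ B v v′
      ; nonempty = λ empty → nonempty N λ v v∈N →
                   let v′ , v∼v′ = forth B v in empty v′ (v , v∈N , v∼v′)
      }

    -- This is what `□` needs: a submodel on one side is matched by its image, and the same relation
    -- is total between the two.
    restrict : {M M′ : Model P ℓ} (B : TotalBisimulation M M′) (N : Submodel M) →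
               TotalBisimulation ⟦ N ⟧ ⟦ image B N ⟧
    restrict B N = record
      { _∼_    = λ u u′ → _∼_ B (value u) (value u′)
      ; V-resp = V-resp B
      ; forth  = λ u → let v′ , v∼v′ = forth B (value u) in
                 (v′ , [ (value u , value∈ N u , v∼v′) ]) , v∼v′
      ; back   = λ u′ → let v , v∈N , v∼v′ = value∈ (image B N) u′ in
                 (v , [ v∈N ]) , v∼v′
      }

    ⊨-resp-∼ : {M M′ : Model P ℓ} (B : TotalBisimulation M M′) (φ : DELKh P) →
               ∀ {w w′} → _∼_ B w w′ → M , w ⊨ φ → M′ , w′ ⊨ φ
    ⊨-resp-∼ B (var p) w∼w′ (lift p∈V) = lift (subst (p ∈_) (V-resp B w∼w′) p∈V)
    ⊨-resp-∼ B (φ ∧̇ ψ) w∼w′ (x , y)    = ⊨-resp-∼ B φ w∼w′ x , ⊨-resp-∼ B ψ w∼w′ y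
    ⊨-resp-∼ B (φ ∨̇ ψ) w∼w′ (inj₁ x)   = inj₁ (⊨-resp-∼ B φ w∼w′ x)
    ⊨-resp-∼ B (φ ∨̇ ψ) w∼w′ (inj₂ y)   = inj₂ (⊨-resp-∼ B ψ w∼w′ y)
    ⊨-resp-∼ B (φ ⇒ ψ) w∼w′ f          =
      ⊨-resp-∼ B ψ w∼w′ ∘ f ∘ ⊨-resp-∼ (symmetric B) φ w∼w′
    ⊨-resp-∼ B (K φ)   w∼w′ k v′       =
      let v , v∼v′ = back B v′ in ⊨-resp-∼ B φ v∼v′ (k v)
    ⊨-resp-∼ B (□ φ)   {w′ = w′} w∼w′ b N′ w′∈N′ =
      -- The submodel `N′` is pulled back to `M` along the converse relation; `b` applies to the
      -- pullback, and the restricted relation carries the result to `N′`.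
      ⊨-resp-∼ (symmetric (restrict (symmetric B) N′)) φ w∼w′
        (b (image (symmetric B) N′) (w′ , w′∈N′ , w∼w′))
    ⊨-resp-∼ B (Kh α)  w∼w′ (lift (x , r)) =
      lift (x , λ v′ → let v , v∼v′ = back B v′ in R-resp-V α (V-resp B v∼v′) (r v))

    whole : (M : Model P ℓ) → Submodel M
    whole M = record
      { worlds   = λ _ → Lift ℓ ⊤
      ; nonempty = λ empty → nonempty M λ v → empty v (lift tt)
      }

    -- `□ φ` yields `φ` only in submodels, and the improper one is a copy of `M` rather than `M`
    -- itself.
    whole-∼ : (M : Model P ℓ) → TotalBisimulation ⟦ whole M ⟧ M
    whole-∼ M = record
      { _∼_    = λ u v → value u ≡ v
      ; V-resp = cong (V M)
      ; forth  = λ u → value u , refl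
      ; back   = λ v → (v , [ lift tt ]) , refl
      }

    -- Membership in `N′` makes sense only for a world already equipped with membership in `N`,
    -- hence the dependent pair.
    flatten : {M : Model P ℓ} (N : Submodel M) → Submodel ⟦ N ⟧ → Submodel M
    flatten N N′ = record
      { worlds   = λ v → ∃ λ (v∈N : v ∈ worlds N) → (v , [ v∈N ]) ∈ worlds N′
      ; nonempty = λ empty → nonempty N′ λ u u∈N′ → empty (value u) (value∈ N u , u∈N′)
      }

    flatten-∼ : {M : Model P ℓ} (N : Submodel M) (N′ : Submodel ⟦ N ⟧) →
                TotalBisimulation ⟦ flatten N N′ ⟧ ⟦ N′ ⟧
    flatten-∼ {M} N N′ = record
      { _∼_    = λ u u′ → value u ≡ value (value u′)
      ; V-resp = cong (V M)
      ; forth  = λ u → let v∈N , v∈N′ = value∈ (flatten N N′) u in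
                 ((value u , [ v∈N ]) , [ v∈N′ ]) , refl
      ; back   = λ u′ → (value (value u′) , [ (value∈ N (value u′) , value∈ N′ u′) ]) , refl
      }

    mutual

      -- Each direction calls the other on the antecedent of an implication.
      resolvable⇒⊨ : {M : Model P ℓ} {w : World M} (α : Prp P) →
                     w ∈ Resolvable M α → M , w ⊨ ⌜ α ⌝
      resolvable⇒⊨ (var p) (_ , p∈V)               = lift p∈V
      resolvable⇒⊨ ⊥̇       (_ , lift ())
      resolvable⇒⊨ (α ∧̇ β) ((x , y) , rα , rβ)     = resolvable⇒⊨ α (x , rα) , resolvable⇒⊨ β (y , rβ)
      resolvable⇒⊨ (α ∨̇ β) (inj₁ x , rα)           = inj₁ (resolvable⇒⊨ α (x , rα))
      resolvable⇒⊨ (α ∨̇ β) (inj₂ y , rβ)           = inj₂ (resolvable⇒⊨ β (y , rβ))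
      resolvable⇒⊨ (α ⇒ β) (f , rf) a              =
        let x , rα = ⊨⇒resolvable α a in resolvable⇒⊨ β (f x , rf rα)

      ⊨⇒resolvable : {M : Model P ℓ} {w : World M} (α : Prp P) →
                     M , w ⊨ ⌜ α ⌝ → w ∈ Resolvable M α
      ⊨⇒resolvable (var p) (lift p∈V) = tt , p∈V
      ⊨⇒resolvable (α ∧̇ β) (a , b)    =
        let x , rα = ⊨⇒resolvable α a
            y , rβ = ⊨⇒resolvable β b
        in (x , y) , rα , rβ
      ⊨⇒resolvable (α ∨̇ β) (inj₁ a)   = let x , rα = ⊨⇒resolvable α a in inj₁ x , rα
      ⊨⇒resolvable (α ∨̇ β) (inj₂ b)   = let y , rβ = ⊨⇒resolvable β b in inj₂ y , rβ
      -- At a single world a constant function suffices: its value resolves `β` if `α` holds, and is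
      -- arbitrary otherwise, since `α` then has no resolution.
      ⊨⇒resolvable {M} {w} (α ⇒ β) f with em {M , w ⊨ ⌜ α ⌝}
      ... | yes a = let y , rβ = ⊨⇒resolvable β (f a) in const y , λ _ → rβ
      ... | no ¬a = const (S-inhabited β) , λ rα → contradiction (resolvable⇒⊨ α (_ , rα)) ¬a

    ⊨-resp-V : {M M′ : Model P ℓ} {w : World M} {w′ : World M′} (α : Prp P) →
               V M w ≡ V M′ w′ → M , w ⊨ ⌜ α ⌝ → M′ , w′ ⊨ ⌜ α ⌝
    ⊨-resp-V α eq a = let x , r = ⊨⇒resolvable α a in resolvable⇒⊨ α (x , R-resp-V α eq r)

    ◇Kh-sound : (α : Prp P) (M : Model P ℓ) (w : World M) → M , w ⊨ ⌜ α ⌝ ⇒ ◇ (Kh α)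
    ◇Kh-sound α M w a □¬Kh =
      let x , r = ⊨⇒resolvable α a
          N     = submodel (λ v → x ∈ R M v α) (w , r)
      in □¬Kh N r (lift (x , λ u → R-resp-V α refl (value∈ N u)))

    Kh-⇒-sound : (α β : Prp P) (M : Model P ℓ) (w : World M) →
                 M , w ⊨ Kh (α ⇒ β) ⇔̇ K (□ (Kh α ⇒ Kh β))
    Kh-⇒-sound α β M w = to , from
      where
      to : M , w ⊨ Kh (α ⇒ β) ⇒ K (□ (Kh α ⇒ Kh β))
      to (lift (f , rf)) _ N _ (lift (x , rα)) =
        lift (f x , λ u → R-resp-V β refl (rf (value u) (R-resp-V α refl (rα u))))

      from : M , w ⊨ K (□ (Kh α ⇒ Kh β)) ⇒ Kh (α ⇒ β)
      from k = lift (proj₁ ∘ choice , λ v {x} → proj₂ (choice x) v)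
        where
        choice : ∀ x → ∃ λ y → ∀ v → x ∈ R M v α → y ∈ R M v β
        choice x with em-ℓ {∃ λ v → x ∈ R M v α}
        -- No world has the resolution `x`, so any value will do.
        ... | no  none        = S-inhabited β , λ v r → contradiction (v , r) none
        ... | yes some@(v , r) =
          -- All worlds of `N` share the resolution `x`, so `Kh α` holds there and `k` yields one
          -- `y` for all of `N`. Outside `N` nothing is required of `y`.
          let N            = submodel (λ u → x ∈ R M u α) some
              lift (y , h) = k v N r (lift (x , λ u → R-resp-V α refl (value∈ N u)))
          in y , λ u s → R-resp-V β refl (h (u , [ s ]))

    ◇K-sound : ∀ {k} (α : Prp P) (αs : Vec (Prp P) k) (M : Model P ℓ) (w : World M) →
               M , w ⊨ ⌜ α ⌝ ∧̇ ⋀ (map (λ αᵢ → K̂ ⌜ α ∧̇ αᵢ ⌝) αs)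
                       ⇒ ◇ (K ⌜ α ⌝ ∧̇ ⋀ (map (λ αᵢ → K̂ ⌜ αᵢ ⌝) αs))
    ◇K-sound α αs M w (a , as) □¬ =
      □¬ N w∈N
        ( (λ u → ⊨-resp-V α refl (resolvable⇒⊨ α (value∈ N u)))
        -- A world of `M` satisfying `α` and `αᵢ` lies in `N` and still satisfies `αᵢ` there, so
        -- refuting `αᵢ` throughout `N` refutes the conjunction throughout `M`.
        , ⋀-map (λ αᵢ K̂ααᵢ K¬αᵢ → K̂ααᵢ λ v (b , c) →
                   lift (lower (K¬αᵢ (v , [ ⊨⇒resolvable α b ]) (⊨-resp-V αᵢ refl c))))
                αs as)
      where
      w∈N : w ∈ Resolvable M α
      w∈N = ⊨⇒resolvable α a

      N : Submodel M
      N = submodel (Resolvable M α) (w , w∈N)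

    -- Excluded middle turns truth at `w` into a Boolean valuation of the letters of `τ`. For a
    -- tautology the Boolean is `true`, which gives truth at `w`.
    eval-reflects : (M : Model P ℓ) (w : World M) {A : Set} (σ : A → DELKh P) (τ : Prp A) →
                    Reflects (M , w ⊨ τ ⟪ σ ⟫) (eval (λ a → does (em {M , w ⊨ σ a})) τ)
    eval-reflects M w σ (var a) = proof em
    eval-reflects M w σ ⊥̇       = ofⁿ λ ()
    eval-reflects M w σ (α ∧̇ β) = eval-reflects M w σ α ×-reflects eval-reflects M w σ β
    eval-reflects M w σ (α ∨̇ β) = eval-reflects M w σ α ⊎-reflects eval-reflects M w σ β
    eval-reflects M w σ (α ⇒ β) = eval-reflects M w σ α →-reflects eval-reflects M w σ β

    soundness : {φ : DELKh P} → ⊢ φ → (M : Model P ℓ) (w : World M) → M , w ⊨ φ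
    soundness (taut τ valid σ) M w = invert (subst (Reflects _) (valid _) (eval-reflects M w σ τ))
    soundness (K-K φ ψ)   M w = λ f x v → f v (x v)
    soundness (K-T φ)     M w = λ k → k w
    -- The unfolded meaning of `K φ` does not mention the world, so the hypothesis itself serves at
    -- every other one.
    soundness (K-4 φ)     M w = λ k _ → k
    soundness (K-5 φ)     M w = λ ¬k _ → ¬k
    soundness (□-K φ ψ)   M w = λ f x N w∈N → f N w∈N (x N w∈N)
    soundness (□-T φ)     M w = λ b → ⊨-resp-∼ (whole-∼ M) φ refl (b (whole M) (lift tt))
    soundness (□-4 φ)     M w = λ b N w∈N N′ w∈N′ →
      ⊨-resp-∼ (flatten-∼ N N′) φ refl (b (flatten N N′) (w∈N , w∈N′))
    soundness (K□ φ)      M w = λ k N w∈N u → k (value u) N (value∈ N u)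
    soundness (pers α)    M w = λ a N w∈N → ⊨-resp-V α refl a
    soundness (◇Kh α)     M w = ◇Kh-sound α M w
    soundness (Kh-K α)    M w = λ (lift (x , r)) v → resolvable⇒⊨ α (x , r v)
    soundness (K-Kh p)    M w = λ k → lift (tt , lower ∘ k)
    soundness Kh-⊥        M w = (λ (lift (_ , r)) → lift (lower (r w))) , λ ()
    -- A uniform resolution carries one tag, which fixes the same disjunct for all worlds.
    soundness (Kh-∨ α β)  M w =
      (λ { (lift (inj₁ x , r)) → inj₁ (lift (x , r)) ; (lift (inj₂ y , r)) → inj₂ (lift (y , r)) }) ,
      (λ { (inj₁ (lift (x , r))) → lift (inj₁ x , r) ; (inj₂ (lift (y , r))) → lift (inj₂ y , r) })
    soundness (Kh-∧ α β)  M w =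
      (λ (lift ((x , y) , r)) → lift (x , proj₁ ∘ r) , lift (y , proj₂ ∘ r)) ,
      (λ (lift (x , r) , lift (y , s)) → lift ((x , y) , λ v → r v , s v))
    soundness (Kh-⇒ α β)  M w = Kh-⇒-sound α β M w
    soundness (Kh-4 α)    M w = λ k _ → k
    soundness (Kh-5 α)    M w = λ ¬k _ → ¬k
    soundness (◇K _ α αs) M w = ◇K-sound α αs M w
    soundness (mp d e)    M w = soundness d M w (soundness e M w)
    soundness (nec-K d)   M w = soundness d M
    soundness (nec-□ d)   M w = λ N w∈N → soundness d ⟦ N ⟧ (w , [ w∈N ])

theorem37 : ∀ {ℓ : Level} → ExcludedMiddle (suc ℓ) →
    (P : Set) → P ↣ ℕ →
    (φ : DELKh P) → ⊢ φ →
    (M : Model P ℓ) (w : Model.World M) → M , w ⊨ φ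
theorem37 em P _ φ d M w = soundness em d M w
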